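{- Let $G$ be a finite simple graph of order $n$. Then $$Mo^\star(G)\leq \left(\frac{2}{\sqrt{3}}-1\right)n^3\leq 0.1548\,n^3.$$
   Context: For a finite simple graph $G$ of order $n$ and a vertex $u$, $d_G(u)$ denotes the degree of $u$ in $G$. The parameter $Mo^\star(G)$ is defined as $Mo^\star(G)=\sum_{uv\in E(G)}\big(n-\min\{d_G(u),d_G(v)\}\big)$, the sum running over all edges $uv$ of $G$. -}

module Defs where

open import Data.Nat using (ℕ; _+_; _∸_; _⊓_; _<ᵇ_)
open import Data.Bool using (Bool; true; false; if_then_else_; _∧_)
open import Data.Fin using (Fin; toℕ)
open import Data.List using (List; map; allFin)
open import Data.Nat.ListAction using (sum)
open import Relation.Binary.PropositionalEquality using (_≡_)

record SimpleGraph (n : ℕ) : Set where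
  field
    adj    : Fin n → Fin n → Bool
    sym    : ∀ u v → adj u v ≡ adj v u
    irrefl : ∀ u → adj u u ≡ false

open SimpleGraph public

deg : ∀ {n} → SimpleGraph n → Fin n → ℕ
deg {n} G u = sum (map (λ v → if adj G u v then 1 else 0) (allFin n))

-- Mo*(G) = Σ_{uv ∈ E(G)} (n - min{d(u), d(v)}),
-- each edge {u,v} counted once, via the pair with toℕ u < toℕ v.
MoStar : ∀ {n} → SimpleGraph n → ℕ
MoStar {n} G =
  sum (map (λ u →
    sum (map (λ v →
      if adj G u v ∧ (toℕ u <ᵇ toℕ v)
        then n ∸ (deg G u ⊓ deg G v)
        else 0) (allFin n))) (allFin n))

{-# OPTIONS --safe #-}
module Submission where

open import Defs
open import Data.Nat using (ℕ; _+_; _*_; _^_; _≤_)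
open import Data.Product using (_×_)

open import Data.Bool using (true; false; T; if_then_else_; _∧_)
open import Data.Fin using (Fin; toℕ)
open import Data.Integer as ℤ using (ℤ; +_; 0ℤ; 1ℤ)
import Data.Integer.Properties as ℤₚ
open import Data.Integer.Tactic.RingSolver using (solve-∀)
open import Data.List using (List; []; _∷_; map; length; filter; allFin)
import Data.List.Extrema as Extrema
open import Data.List.Membership.Propositional using (_∈_; lose)
open import Data.List.Properties using (filter-notAll; length-map; length-tabulate)
open import Data.List.Relation.Unary.All as All using (All; []; _∷_)
open import Data.List.Relation.Unary.All.Properties using (¬Any⇒All¬; all-filter)
open import Data.List.Relation.Unary.Any as Any using (Any; any?; here; there)
open import Data.Nat as ℕ using (_∸_; _⊓_; _<ᵇ_; zero; suc)
open import Data.Nat.Induction using (Acc; acc; <-wellFounded)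
open import Data.Nat.ListAction using (sum)
import Data.Nat.Properties as ℕₚ
import Data.Nat.Tactic.RingSolver as ℕ-Solver
open import Data.Product using (Σ; _,_)
open import Data.Sum using (inj₁; inj₂)
open import Function using (_∘_; id)
open import Level using (0ℓ)
open import Relation.Binary.PropositionalEquality
  using (_≡_; refl; trans; cong; cong₂; subst; subst₂; module ≡-Reasoning)
  renaming (sym to ≡-sym)
open import Relation.Nullary using (¬_; Dec; yes; no; does; contradiction)
open import Relation.Nullary.Decidable using (¬?)
open import Relation.Unary using (Pred; Decidable)

-- Put c_u = n - d(u) and fix weights a ≤ b. Since
--   (a + b) max(x, y) ≤ b (x + y) + (a x - b y)⁺ + (a y - b x)⁺
-- and u lies on n - c_u edges, (a + b) Mo* is at most
--   Σ_u b c_u (n - c_u) + Σ_{u,v} (a c_u - b c_v)⁺.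
-- For arbitrary numbers c_u, 3b times this is at most (a² - ab + b²) n³, by induction on the
-- number of elements: those within the factor b / a of the largest do not interact, so
-- all of them may be replaced by the best one; once the block of copies of the largest is
-- isolated from the rest, the slack of splitting it off is a sum of two squares. Choosing
-- a : b = 3 Mo* + n³ : 2 n³ turns the resulting family of bounds into the quadratic one.

-- Integer sums over lists

private
  variable
    A B : Set

∑ : List A → (A → ℤ) → ℤ
∑ []       f = 0ℤ
∑ (x ∷ xs) f = f x ℤ.+ ∑ xs f

∑-cong : {f g : A → ℤ} {xs : List A} → All (λ x → f x ≡ g x) xs → ∑ xs f ≡ ∑ xs g
∑-cong []       = refl
∑-cong (e ∷ es) = cong₂ ℤ._+_ e (∑-cong es)

∑-mono-≤ : {f g : A → ℤ} {xs : List A} → All (λ x → f x ℤ.≤ g x) xs → ∑ xs f ℤ.≤ ∑ xs g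
∑-mono-≤ []       = ℤₚ.≤-refl
∑-mono-≤ (e ∷ es) = ℤₚ.+-mono-≤ e (∑-mono-≤ es)

∑-distrib-+ : (f g : A → ℤ) (xs : List A) → ∑ xs (λ x → f x ℤ.+ g x) ≡ ∑ xs f ℤ.+ ∑ xs g
∑-distrib-+ f g []       = refl
∑-distrib-+ f g (x ∷ xs) =
  trans (cong (λ s → f x ℤ.+ g x ℤ.+ s) (∑-distrib-+ f g xs)) (lemma (f x) (g x) (∑ xs f) (∑ xs g))
  where
  lemma : ∀ p q r s → p ℤ.+ q ℤ.+ (r ℤ.+ s) ≡ p ℤ.+ r ℤ.+ (q ℤ.+ s)
  lemma = solve-∀

*-distribˡ-∑ : (k : ℤ) (f : A → ℤ) (xs : List A) → k ℤ.* ∑ xs f ≡ ∑ xs (λ x → k ℤ.* f x)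
*-distribˡ-∑ k f []       = ℤₚ.*-zeroʳ k
*-distribˡ-∑ k f (x ∷ xs) =
  trans (ℤₚ.*-distribˡ-+ k (f x) (∑ xs f)) (cong (λ s → k ℤ.* f x ℤ.+ s) (*-distribˡ-∑ k f xs))

∑-const : (k : ℤ) (xs : List A) → ∑ xs (λ _ → k) ≡ + length xs ℤ.* k
∑-const k []       = refl
∑-const k (x ∷ xs) = trans (cong (λ s → k ℤ.+ s) (∑-const k xs)) (≡-sym (ℤₚ.suc-* (+ length xs) k))

∑-zero : (xs : List A) → ∑ xs (λ _ → 0ℤ) ≡ 0ℤ
∑-zero xs = trans (∑-const 0ℤ xs) (ℤₚ.*-zeroʳ (+ length xs))

∑-comm : (f : A → B → ℤ) (xs : List A) (ys : List B) →
  ∑ xs (λ x → ∑ ys (f x)) ≡ ∑ ys (λ y → ∑ xs (λ x → f x y))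
∑-comm f []       ys = ≡-sym (∑-zero ys)
∑-comm f (x ∷ xs) ys =
  trans (cong (λ s → ∑ ys (f x) ℤ.+ s) (∑-comm f xs ys))
        (≡-sym (∑-distrib-+ (f x) (λ y → ∑ xs (λ x′ → f x′ y)) ys))

∑-filter : {P : Pred A 0ℓ} (P? : Decidable P) (f : A → ℤ) (xs : List A) →
  ∑ xs f ≡ ∑ (filter P? xs) f ℤ.+ ∑ (filter (¬? ∘ P?) xs) f
∑-filter P? f []       = refl
∑-filter P? f (x ∷ xs) with does (P? x)
... | true  = trans (cong (λ s → f x ℤ.+ s) (∑-filter P? f xs)) (≡-sym (ℤₚ.+-assoc (f x) _ _))
... | false = trans (cong (λ s → f x ℤ.+ s) (∑-filter P? f xs)) (lemma (f x) (∑ (filter P? xs) f) _)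
  where
  lemma : ∀ p q r → p ℤ.+ (q ℤ.+ r) ≡ q ℤ.+ (p ℤ.+ r)
  lemma = solve-∀

length-filter-split : {P : Pred A 0ℓ} (P? : Decidable P) (xs : List A) →
  length xs ≡ length (filter P? xs) + length (filter (¬? ∘ P?) xs)
length-filter-split P? []       = refl
length-filter-split P? (x ∷ xs) with does (P? x)
... | true  = cong suc (length-filter-split P? xs)
... | false = trans (cong suc (length-filter-split P? xs)) (≡-sym (ℕₚ.+-suc _ _))

∑-map : (h : A → B) (f : B → ℤ) (xs : List A) → ∑ (map h xs) f ≡ ∑ xs (f ∘ h)
∑-map h f []       = refl
∑-map h f (x ∷ xs) = cong (λ s → f (h x) ℤ.+ s) (∑-map h f xs)

pos-sum : (f : A → ℕ) (xs : List A) → + sum (map f xs) ≡ ∑ xs (λ x → + f x)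
pos-sum f []       = refl
pos-sum f (x ∷ xs) = trans (ℤₚ.pos-+ (f x) _) (cong (λ s → + f x ℤ.+ s) (pos-sum f xs))

-- Truncated subtraction and nonnegative integers

pos-∸ : ∀ {m n} → n ≤ m → + (m ∸ n) ≡ + m ℤ.- + n
pos-∸ {m} {n} n≤m = trans (≡-sym (ℤₚ.⊖-≥ n≤m)) (≡-sym (ℤₚ.m-n≡m⊖n m n))

0≤i*i : ∀ i → 0ℤ ℤ.≤ i ℤ.* i
0≤i*i (+ n)        = subst (0ℤ ℤ.≤_) (ℤₚ.pos-* n n) (ℤ.+≤+ ℕ.z≤n)
0≤i*i (ℤ.-[1+ n ]) = ℤ.+≤+ ℕ.z≤n

0≤i*j : ∀ {i j} → 0ℤ ℤ.≤ i → 0ℤ ℤ.≤ j → 0ℤ ℤ.≤ i ℤ.* j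
0≤i*j {+ m} {+ n} _ _ = subst (0ℤ ℤ.≤_) (ℤₚ.pos-* m n) (ℤ.+≤+ ℕ.z≤n)

-- The weighted inequality for arbitrary lists of numbers

module Weighted (a b : ℕ) (a≤b : a ≤ b) where

  a′ b′ Q : ℤ
  a′ = + a
  b′ = + b
  Q  = a′ ℤ.* a′ ℤ.- a′ ℤ.* b′ ℤ.+ b′ ℤ.* b′

  mass : List ℕ → ℤ
  mass xs = ∑ xs (λ x → + x)

  excess : ℕ → ℕ → ℤ
  excess x y = + (a * x ∸ b * y)

  gain : ℤ → List ℕ → ℕ → ℤ
  gain N ys x = b′ ℤ.* (+ x ℤ.* (N ℤ.- + x)) ℤ.+ ∑ ys (excess x)

  total : ℤ → List ℕ → ℤ
  total N xs = ∑ xs (gain N xs)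

  -- total N of the list xs extended by t copies of an upper bound c of xs
  padded : ℤ → ℕ → ℕ → List ℕ → ℤ
  padded N t c xs = + t ℤ.* gain N xs c ℤ.+ total N xs

  -- For `a > 0`, the condition `y ≥ (a / b) c` without division. It is the exact condition for
  -- `excess c y` to vanish.
  Near : ℕ → ℕ → Set
  Near c y = a * c ≤ b * y

  near? : ∀ c → Decidable (Near c)
  near? c y = a * c ℕ.≤? b * y

  near far : ℕ → List ℕ → List ℕ
  near c = filter (near? c)
  far  c = filter (¬? ∘ near? c)

  excess-near : ∀ {c x y} → x ≤ c → Near c y → excess x y ≡ 0ℤ
  excess-near {c} x≤c ac≤by =
    cong +_ (ℕₚ.m≤n⇒m∸n≡0 (ℕₚ.≤-trans (ℕₚ.*-monoʳ-≤ a x≤c) ac≤by))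

  gain-far : ∀ N {c x} xs → x ≤ c → gain N xs x ≡ gain N (far c xs) x
  gain-far N {c} {x} xs x≤c = cong (λ s → b′ ℤ.* (+ x ℤ.* (N ℤ.- + x)) ℤ.+ s) (begin
    ∑ xs (excess x)                                  ≡⟨ ∑-filter (near? c) (excess x) xs ⟩
    ∑ (near c xs) (excess x) ℤ.+ ∑ (far c xs) (excess x)
      ≡⟨ cong (ℤ._+ ∑ (far c xs) (excess x))
          (trans (∑-cong (All.map (excess-near x≤c) (all-filter (near? c) xs))) (∑-zero (near c xs))) ⟩
    0ℤ ℤ.+ ∑ (far c xs) (excess x)                   ≡⟨ ℤₚ.+-identityˡ _ ⟩
    ∑ (far c xs) (excess x)                          ∎)
    where open ≡-Reasoning

  -- Mutually near elements have no excess over each other, so total is separable in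
  -- them and all of them may be moved to the most profitable value.
  pool : ∀ N t c xs → All (_≤ c) xs → Σ ℕ λ x → All (_≤ x) (far c xs) ×
    (padded N t c xs ℤ.≤ padded N (t + length (near c xs)) x (far c xs))
  pool N t c xs xs≤c = x , far≤x , (begin
    + t ℤ.* gain N xs c ℤ.+ ∑ xs (gain N xs)
      ≡⟨ cong₂ (λ p q → + t ℤ.* p ℤ.+ q) (gain-far N xs ℕₚ.≤-refl)
           (trans (∑-cong (All.map (gain-far N xs) xs≤c)) (∑-filter (near? c) g xs)) ⟩
    + t ℤ.* g c ℤ.+ (∑ (near c xs) g ℤ.+ ∑ (far c xs) g)
      ≤⟨ ℤₚ.+-mono-≤ (ℤₚ.*-monoˡ-≤-nonNeg (+ t) (E.f[⊥]≤f[argmax] {f = g} c (near c xs)))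
           (ℤₚ.+-monoˡ-≤ (∑ (far c xs) g) (∑-mono-≤ (E.f[xs]≤f[argmax] {f = g} c (near c xs)))) ⟩
    + t ℤ.* g x ℤ.+ (∑ (near c xs) (λ _ → g x) ℤ.+ ∑ (far c xs) g)
      ≡⟨ cong (λ s → + t ℤ.* g x ℤ.+ (s ℤ.+ ∑ (far c xs) g)) (∑-const (g x) (near c xs)) ⟩
    + t ℤ.* g x ℤ.+ (+ length (near c xs) ℤ.* g x ℤ.+ ∑ (far c xs) g)
      ≡⟨ lemma (+ t) (g x) (+ length (near c xs)) _ ⟩
    (+ t ℤ.+ + length (near c xs)) ℤ.* g x ℤ.+ ∑ (far c xs) g
      ≡⟨ cong (λ s → s ℤ.* g x ℤ.+ ∑ (far c xs) g) (≡-sym (ℤₚ.pos-+ t _)) ⟩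
    + (t + length (near c xs)) ℤ.* g x ℤ.+ ∑ (far c xs) g ∎)
    where
    module E = Extrema ℤₚ.≤-totalOrder
    open ℤₚ.≤-Reasoning

    g : ℕ → ℤ
    g = gain N (far c xs)

    x : ℕ
    x = E.argmax g c (near c xs)

    -- The candidate `c` is itself near because `a ≤ b`, so the maximiser is near whichever
    -- candidate wins. A far `y` then satisfies `b * y < a * c ≤ b * x`, which keeps `x` an upper
    -- bound.
    x-near : Near c x
    x-near = E.argmax-all g {P = λ y → a * c ≤ b * y} (ℕₚ.*-monoˡ-≤ c a≤b) (all-filter (near? c) xs)

    far≤x : All (_≤ x) (far c xs)
    far≤x = All.map
      (λ {y} by≱ac → ℕₚ.<⇒≤ (ℕₚ.*-cancelˡ-< b y x (ℕₚ.<-≤-trans (ℕₚ.≰⇒> by≱ac) x-near)))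
      (all-filter (¬? ∘ near? c) xs)

    lemma : ∀ t g p s → t ℤ.* g ℤ.+ (p ℤ.* g ℤ.+ s) ≡ (t ℤ.+ p) ℤ.* g ℤ.+ s
    lemma = solve-∀

  Bounded : ℕ → ℤ → Set
  Bounded n s = + 3 ℤ.* b′ ℤ.* s ℤ.≤ Q ℤ.* (+ n ℤ.* + n ℤ.* + n)

  -- Each gain is affine in `N` with slope `b` times the entry; the excess part does not involve
  -- `N`.
  total-shift : ∀ N t xs → total (t ℤ.+ N) xs ≡ total N xs ℤ.+ t ℤ.* (b′ ℤ.* mass xs)
  total-shift N t xs = begin
    ∑ xs (gain (t ℤ.+ N) xs)
      ≡⟨ ∑-cong (All.universal (λ x → lemma b′ N t (+ x) (∑ xs (excess x))) xs) ⟩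
    ∑ xs (λ x → gain N xs x ℤ.+ t ℤ.* (b′ ℤ.* + x))
      ≡⟨ ∑-distrib-+ (gain N xs) _ xs ⟩
    total N xs ℤ.+ ∑ xs (λ x → t ℤ.* (b′ ℤ.* + x))
      ≡⟨ cong (λ s → total N xs ℤ.+ s)
           (trans (cong (t ℤ.*_) (*-distribˡ-∑ b′ (λ x → + x) xs)) (*-distribˡ-∑ t _ xs)) ⟨
    total N xs ℤ.+ t ℤ.* (b′ ℤ.* mass xs) ∎
    where
    open ≡-Reasoning
    lemma : ∀ b N t x e → b ℤ.* (x ℤ.* (t ℤ.+ N ℤ.- x)) ℤ.+ e
      ≡ b ℤ.* (x ℤ.* (N ℤ.- x)) ℤ.+ e ℤ.+ t ℤ.* (b ℤ.* x)
    lemma = solve-∀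

  -- No truncation takes effect when every entry is far below `c`, so only the length and the mass
  -- of `xs` remain. In `cut` this mass term cancels the one from `total-shift`.
  excess-far : ∀ c xs → All (¬_ ∘ Near c) xs →
    ∑ xs (excess c) ≡ + length xs ℤ.* (a′ ℤ.* + c) ℤ.- b′ ℤ.* mass xs
  excess-far c []       []       = ≡-sym (cong (λ z → 0ℤ ℤ.- z) (ℤₚ.*-zeroʳ b′))
  excess-far c (x ∷ xs) (p ∷ ps) = begin
    excess c x ℤ.+ ∑ xs (excess c)
      ≡⟨ cong₂ ℤ._+_ (trans (pos-∸ (ℕₚ.≰⇒≥ p)) (cong₂ ℤ._-_ (ℤₚ.pos-* a c) (ℤₚ.pos-* b x)))
           (excess-far c xs ps) ⟩
    a′ ℤ.* + c ℤ.- b′ ℤ.* + x ℤ.+ (+ length xs ℤ.* (a′ ℤ.* + c) ℤ.- b′ ℤ.* mass xs)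
      ≡⟨ lemma a′ b′ (+ c) (+ x) (+ length xs) (mass xs) ⟩
    (1ℤ ℤ.+ + length xs) ℤ.* (a′ ℤ.* + c) ℤ.- b′ ℤ.* (+ x ℤ.+ mass xs) ∎
    where
    open ≡-Reasoning
    lemma : ∀ a b c x l s → a ℤ.* c ℤ.- b ℤ.* x ℤ.+ (l ℤ.* (a ℤ.* c) ℤ.- b ℤ.* s)
      ≡ (1ℤ ℤ.+ l) ℤ.* (a ℤ.* c) ℤ.- b ℤ.* (x ℤ.+ s)
    lemma = solve-∀

  -- If c exceeds all of xs by the factor b / a, the t copies of c interact with xs
  -- only through its length.
  cut : ∀ t c xs → All (¬_ ∘ Near c) xs → Bounded (length xs) (total (+ length xs) xs) →
    Bounded (t + length xs) (padded (+ (t + length xs)) t c xs)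
  cut t c xs c≫xs ih = begin
    + 3 ℤ.* b′ ℤ.* padded (+ (t + length xs)) t c xs
      ≡⟨ cong (λ N → + 3 ℤ.* b′ ℤ.* padded N t c xs) (ℤₚ.pos-+ t (length xs)) ⟩
    + 3 ℤ.* b′ ℤ.* padded (t′ ℤ.+ n′) t c xs
      ≡⟨ cong (λ s → + 3 ℤ.* b′ ℤ.* s)
           (cong₂ (λ p q → t′ ℤ.* (b′ ℤ.* (c′ ℤ.* (t′ ℤ.+ n′ ℤ.- c′)) ℤ.+ p) ℤ.+ q)
           (excess-far c xs c≫xs) (total-shift n′ t′ xs)) ⟩
    + 3 ℤ.* b′ ℤ.* (t′ ℤ.* (b′ ℤ.* (c′ ℤ.* (t′ ℤ.+ n′ ℤ.- c′))
          ℤ.+ (n′ ℤ.* (a′ ℤ.* c′) ℤ.- b′ ℤ.* mass xs))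
        ℤ.+ (total n′ xs ℤ.+ t′ ℤ.* (b′ ℤ.* mass xs)))
      ≡⟨ lemma a′ b′ c′ t′ n′ (mass xs) (total n′ xs) ⟩
    + 3 ℤ.* b′ ℤ.* total n′ xs ℤ.+ step a′ b′ n′ t′ c′
      ≤⟨ ℤₚ.+-mono-≤ ih (step-bound n′ t′ c′ (ℤ.+≤+ ℕ.z≤n)) ⟩
    Q ℤ.* (n′ ℤ.* n′ ℤ.* n′)
      ℤ.+ (Q ℤ.* ((t′ ℤ.+ n′) ℤ.* (t′ ℤ.+ n′) ℤ.* (t′ ℤ.+ n′)) ℤ.- Q ℤ.* (n′ ℤ.* n′ ℤ.* n′))
      ≡⟨ cancel (Q ℤ.* (n′ ℤ.* n′ ℤ.* n′)) _ ⟩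
    Q ℤ.* ((t′ ℤ.+ n′) ℤ.* (t′ ℤ.+ n′) ℤ.* (t′ ℤ.+ n′))
      ≡⟨ cong (λ N → Q ℤ.* (N ℤ.* N ℤ.* N)) (≡-sym (ℤₚ.pos-+ t (length xs))) ⟩
    Q ℤ.* (+ (t + length xs) ℤ.* + (t + length xs) ℤ.* + (t + length xs)) ∎
    where
    open ℤₚ.≤-Reasoning
    t′ c′ n′ : ℤ
    t′ = + t
    c′ = + c
    n′ = + length xs

    step : (a b n t c : ℤ) → ℤ
    step a b n t c = + 3 ℤ.* b ℤ.* (t ℤ.* (b ℤ.* (c ℤ.* (t ℤ.+ n ℤ.- c)) ℤ.+ a ℤ.* c ℤ.* n))

    lemma : ∀ a b c t n s F →
      + 3 ℤ.* b ℤ.* (t ℤ.* (b ℤ.* (c ℤ.* (t ℤ.+ n ℤ.- c))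
        ℤ.+ (n ℤ.* (a ℤ.* c) ℤ.- b ℤ.* s)) ℤ.+ (F ℤ.+ t ℤ.* (b ℤ.* s)))
      ≡ + 3 ℤ.* b ℤ.* F ℤ.+ + 3 ℤ.* b ℤ.* (t ℤ.* (b ℤ.* (c ℤ.* (t ℤ.+ n ℤ.- c)) ℤ.+ a ℤ.* c ℤ.* n))
    lemma = solve-∀

    cancel : ∀ p q → p ℤ.+ (q ℤ.- p) ≡ q
    cancel = solve-∀

    -- Completing the square in `c` gives the second square. What is left is a quadratic form in `t`
    -- and `n`, and the choice of `Q` makes it a perfect square too.
    identity : ∀ a b n t c →
      + 4 ℤ.* ((a ℤ.* a ℤ.- a ℤ.* b ℤ.+ b ℤ.* b) ℤ.* ((t ℤ.+ n) ℤ.* (t ℤ.+ n) ℤ.* (t ℤ.+ n))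
        ℤ.- (a ℤ.* a ℤ.- a ℤ.* b ℤ.+ b ℤ.* b) ℤ.* (n ℤ.* n ℤ.* n)
        ℤ.- + 3 ℤ.* b ℤ.* (t ℤ.* (b ℤ.* (c ℤ.* (t ℤ.+ n ℤ.- c)) ℤ.+ a ℤ.* c ℤ.* n)))
      ≡ t ℤ.* (((+ 2 ℤ.* a ℤ.- b) ℤ.* t ℤ.+ + 3 ℤ.* (a ℤ.- b) ℤ.* n)
          ℤ.* ((+ 2 ℤ.* a ℤ.- b) ℤ.* t ℤ.+ + 3 ℤ.* (a ℤ.- b) ℤ.* n)
        ℤ.+ + 3 ℤ.* ((b ℤ.* t ℤ.+ (a ℤ.+ b) ℤ.* n ℤ.- + 2 ℤ.* b ℤ.* c)
          ℤ.* (b ℤ.* t ℤ.+ (a ℤ.+ b) ℤ.* n ℤ.- + 2 ℤ.* b ℤ.* c)))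
    identity = solve-∀

    step-bound : ∀ n t c → 0ℤ ℤ.≤ t → step a′ b′ n t c ℤ.≤
      Q ℤ.* ((t ℤ.+ n) ℤ.* (t ℤ.+ n) ℤ.* (t ℤ.+ n)) ℤ.- Q ℤ.* (n ℤ.* n ℤ.* n)
    step-bound n t c 0≤t = ℤₚ.0≤i-j⇒j≤i (ℤₚ.*-cancelˡ-≤-pos 0ℤ _ (+ 4)
      (subst (0ℤ ℤ.≤_) (≡-sym (identity a′ b′ n t c))
        (0≤i*j 0≤t (ℤₚ.+-mono-≤
          (0≤i*i ((+ 2 ℤ.* a′ ℤ.- b′) ℤ.* t ℤ.+ + 3 ℤ.* (a′ ℤ.- b′) ℤ.* n))
          (0≤i*j {+ 3} (ℤ.+≤+ ℕ.z≤n) (0≤i*i (b′ ℤ.* t ℤ.+ (a′ ℤ.+ b′) ℤ.* n ℤ.- + 2 ℤ.* b′ ℤ.* c)))))))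

  -- Induction on the length of `xs`. If some entry is near `c`, `pool` moves all near entries out
  -- of `xs` into the block of copies. Otherwise `cut` asks for the bound on `xs` alone, which is
  -- the case of zero copies with the maximum of `xs` as `c`.
  padded-bound : ∀ xs → Acc ℕ._<_ (length xs) → ∀ t c → All (_≤ c) xs →
    Bounded (t + length xs) (padded (+ (t + length xs)) t c xs)
  padded-bound xs (acc rec) t c xs≤c = by-cases t c xs≤c (any? (near? c) xs)
    where
    module E = Extrema ℕₚ.≤-totalOrder

    pooled : ∀ t c → All (_≤ c) xs → Any (Near c) xs →
      Bounded (t + length xs) (padded (+ (t + length xs)) t c xs)
    pooled t c xs≤c ∃near =
      let N = + (t + length xs)
          (x , far≤x , le) = pool N t c xs xs≤c
          ih = padded-bound (far c xs)
                 (rec (filter-notAll (¬? ∘ near? c) xs (Any.map (λ p ¬p → ¬p p) ∃near)))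
                 (t + length (near c xs)) x far≤x
          size : (t + length (near c xs)) + length (far c xs) ≡ t + length xs
          size = trans (ℕₚ.+-assoc t _ _) (cong (t ℕ.+_) (≡-sym (length-filter-split (near? c) xs)))
      in ℤₚ.≤-trans (ℤₚ.*-monoˡ-≤-nonNeg (+ 3 ℤ.* b′) {{nn}} le)
           (subst (λ n → Bounded n (padded (+ n) (t + length (near c xs)) x (far c xs))) size ih)
      where
      nn : ℤ.NonNegative (+ 3 ℤ.* b′)
      nn = subst ℤ.NonNegative (ℤₚ.pos-* 3 b) _

    total-bounded : ∀ ys → ys ≡ xs → Bounded (length ys) (total (+ length ys) ys)
    total-bounded []       _    = ℤₚ.≤-reflexive (trans (ℤₚ.*-zeroʳ (+ 3 ℤ.* b′)) (≡-sym (ℤₚ.*-zeroʳ Q)))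
    -- The maximum is near itself since `a ≤ b`, so pooling removes at least one entry and the
    -- recursion is on a strictly shorter list.
    total-bounded (y ∷ ys) refl = subst (Bounded (length xs)) (ℤₚ.+-identityˡ _)
      (pooled 0 m ys≤m (lose m∈ys (ℕₚ.*-monoˡ-≤ m a≤b)))
      where
      m : ℕ
      m = E.max y ys

      ys≤m : All (_≤ m) (y ∷ ys)
      ys≤m = E.⊥≤max y ys ∷ E.xs≤max y ys

      m∈ys : m ∈ y ∷ ys
      m∈ys with E.argmax-sel id y ys
      ... | inj₁ m≡y  = here m≡y
      ... | inj₂ m∈ys = there m∈ys

    by-cases : ∀ t c → All (_≤ c) xs → Dec (Any (Near c) xs) →
      Bounded (t + length xs) (padded (+ (t + length xs)) t c xs)
    by-cases t c xs≤c (yes ∃near) = pooled t c xs≤c ∃near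
    by-cases t c xs≤c (no ¬near)  = cut t c xs (¬Any⇒All¬ xs ¬near) (total-bounded xs refl)

  total-bound : ∀ xs → Bounded (length xs) (total (+ length xs) xs)
  total-bound xs = subst (Bounded (length xs)) (ℤₚ.+-identityˡ _)
    (padded-bound xs (<-wellFounded _) 0 (E.max 0 xs) (E.xs≤max 0 xs))
    where module E = Extrema ℕₚ.≤-totalOrder

  -- Rests on `a * x ≤ b * y + (a * x ∸ b * y)`. Adding the other truncated difference makes the
  -- right side symmetric in `x` and `y`, so that it bounds the larger of the two.
  weighted-≤ : ∀ x y → (a + b) * x ≤ (b * x + (a * x ∸ b * y)) + (b * y + (a * y ∸ b * x))
  weighted-≤ x y = begin
    (a + b) * x
      ≡⟨ distrib a b x ⟩
    b * x + a * x
      ≤⟨ ℕₚ.+-monoʳ-≤ (b * x) (ℕₚ.m≤n+m∸n (a * x) (b * y)) ⟩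
    b * x + (b * y + (a * x ∸ b * y))
      ≤⟨ ℕₚ.m≤m+n _ (a * y ∸ b * x) ⟩
    b * x + (b * y + (a * x ∸ b * y)) + (a * y ∸ b * x)
      ≡⟨ shuffle (b * x) (b * y) _ _ ⟩
    (b * x + (a * x ∸ b * y)) + (b * y + (a * y ∸ b * x)) ∎
    where
    open ℕₚ.≤-Reasoning
    distrib : ∀ a b x → (a + b) * x ≡ b * x + a * x
    distrib = ℕ-Solver.solve-∀
    shuffle : ∀ p q r s → p + (q + r) + s ≡ (p + r) + (q + s)
    shuffle = ℕ-Solver.solve-∀

  weighted-⊔-≤ : ∀ x y →
    (a + b) * (x ℕ.⊔ y) ≤ (b * x + (a * x ∸ b * y)) + (b * y + (a * y ∸ b * x))
  weighted-⊔-≤ x y with ℕₚ.⊔-sel x y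
  ... | inj₁ eq rewrite eq = weighted-≤ x y
  ... | inj₂ eq rewrite eq =
    subst ((a + b) * y ≤_) (ℕₚ.+-comm (b * y + (a * y ∸ b * x)) _) (weighted-≤ y x)

-- From graphs to lists of codegrees

module _ {n : ℕ} (G : SimpleGraph n) where

  private
    V : List (Fin n)
    V = allFin n

  length-V : length V ≡ n
  length-V = length-tabulate id

  -- The two strict comparisons exclude each other, so at most one summand survives.
  ordered-≤ : ∀ u v {i} → 0ℤ ℤ.≤ i →
    (if adj G u v ∧ (toℕ u <ᵇ toℕ v) then i else 0ℤ)
      ℤ.+ (if adj G v u ∧ (toℕ v <ᵇ toℕ u) then i else 0ℤ)
      ℤ.≤ (if adj G u v then i else 0ℤ)
  ordered-≤ u v {i} 0≤i rewrite SimpleGraph.sym G v u with adj G u v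
  ... | false = ℤₚ.≤-refl
  ... | true  with toℕ u <ᵇ toℕ v in u<v | toℕ v <ᵇ toℕ u in v<u
  ...   | true  | true  = contradiction
          (ℕₚ.<ᵇ⇒< (toℕ v) (toℕ u) (subst T (≡-sym v<u) _))
          (ℕₚ.<⇒≯ (ℕₚ.<ᵇ⇒< (toℕ u) (toℕ v) (subst T (≡-sym u<v) _)))
  ...   | true  | false = ℤₚ.≤-reflexive (ℤₚ.+-identityʳ i)
  ...   | false | true  = ℤₚ.≤-reflexive (ℤₚ.+-identityˡ i)
  ...   | false | false = 0≤i

  -- A charging argument: the cost of an edge is shared between its ends, `h u v` being paid by `u`
  -- and `h v u` by `v`. Regrouping by payer turns the sum over edges into one over ordered adjacent
  -- pairs.
  MoStar≤∑ : ∀ k (h : Fin n → Fin n → ℤ) → (∀ u v → 0ℤ ℤ.≤ h u v) →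
    (∀ u v → + (k * (n ∸ (deg G u ⊓ deg G v))) ℤ.≤ h u v ℤ.+ h v u) →
    + k ℤ.* + MoStar G ℤ.≤ ∑ V (λ u → ∑ V (λ v → if adj G u v then h u v else 0ℤ))
  MoStar≤∑ k h 0≤h cost≤h = begin
    + k ℤ.* + MoStar G
      ≡⟨ cong (+ k ℤ.*_) (trans (pos-sum (λ u → sum (map (cost u) V)) V)
           (∑-cong (All.universal (λ u → pos-sum (cost u) V) V))) ⟩
    + k ℤ.* ∑ V (λ u → ∑ V (λ v → + cost u v))
      ≡⟨ *-distribˡ-∑ (+ k) (λ u → ∑ V (λ v → + cost u v)) V ⟩
    ∑ V (λ u → + k ℤ.* ∑ V (λ v → + cost u v))
      ≡⟨ ∑-cong (All.universal (λ u → *-distribˡ-∑ (+ k) (λ v → + cost u v) V) V) ⟩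
    ∑ V (λ u → ∑ V (λ v → + k ℤ.* + cost u v))
      ≤⟨ ∑-mono-≤ (All.universal (λ u → ∑-mono-≤ (All.universal (λ v → cost-split u v) V)) V) ⟩
    ∑ V (λ u → ∑ V (λ v → up u v ℤ.+ down u v))
      ≡⟨ ∑∑-distrib-+ up down ⟩
    ∑ V (λ u → ∑ V (up u)) ℤ.+ ∑ V (λ u → ∑ V (down u))
      -- Exchanging the roles of `u` and `v` in the `down` half puts the payer first in both halves.
      ≡⟨ cong (λ s → ∑ V (λ u → ∑ V (up u)) ℤ.+ s) (∑-comm down V V) ⟩
    ∑ V (λ u → ∑ V (up u)) ℤ.+ ∑ V (λ u → ∑ V (λ v → down v u))
      ≡⟨ ∑∑-distrib-+ up (λ u v → down v u) ⟨
    ∑ V (λ u → ∑ V (λ v → up u v ℤ.+ down v u))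
      ≤⟨ ∑-mono-≤ (All.universal (λ u → ∑-mono-≤ (All.universal (λ v → ordered-≤ u v (0≤h u v)) V)) V) ⟩
    ∑ V (λ u → ∑ V (λ v → if adj G u v then h u v else 0ℤ)) ∎
    where
    open ℤₚ.≤-Reasoning
    cost : Fin n → Fin n → ℕ
    cost u v = if adj G u v ∧ (toℕ u <ᵇ toℕ v) then n ∸ (deg G u ⊓ deg G v) else 0

    up down : Fin n → Fin n → ℤ
    up   u v = if adj G u v ∧ (toℕ u <ᵇ toℕ v) then h u v else 0ℤ
    down u v = if adj G u v ∧ (toℕ u <ᵇ toℕ v) then h v u else 0ℤ

    cost-split : ∀ u v → + k ℤ.* + cost u v ℤ.≤ up u v ℤ.+ down u v
    cost-split u v with adj G u v ∧ (toℕ u <ᵇ toℕ v)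
    ... | true  = subst (ℤ._≤ h u v ℤ.+ h v u) (ℤₚ.pos-* k _) (cost≤h u v)
    ... | false = ℤₚ.≤-reflexive (ℤₚ.*-zeroʳ (+ k))

    ∑∑-distrib-+ : (f g : Fin n → Fin n → ℤ) → ∑ V (λ u → ∑ V (λ v → f u v ℤ.+ g u v))
      ≡ ∑ V (λ u → ∑ V (f u)) ℤ.+ ∑ V (λ u → ∑ V (g u))
    ∑∑-distrib-+ f g = trans (∑-cong (All.universal (λ u → ∑-distrib-+ (f u) (g u) V) V))
      (∑-distrib-+ (λ u → ∑ V (f u)) (λ u → ∑ V (g u)) V)

  pos-deg : ∀ u → + deg G u ≡ ∑ V (λ v → + (if adj G u v then 1 else 0))
  pos-deg u = pos-sum (λ v → if adj G u v then 1 else 0) V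

  deg≤n : ∀ u → deg G u ≤ n
  deg≤n u = ℤₚ.drop‿+≤+ (begin
    + deg G u                                    ≡⟨ pos-deg u ⟩
    ∑ V (λ v → + (if adj G u v then 1 else 0))   ≤⟨ ∑-mono-≤ (All.universal (λ v → indicator≤1 (adj G u v)) V) ⟩
    ∑ V (λ _ → 1ℤ)                               ≡⟨ ∑-const 1ℤ V ⟩
    + length V ℤ.* 1ℤ                            ≡⟨ ℤₚ.*-identityʳ _ ⟩
    + length V                                   ≡⟨ cong +_ length-V ⟩
    + n                                          ∎)
    where
    open ℤₚ.≤-Reasoning
    indicator≤1 : ∀ c → + (if c then 1 else 0) ℤ.≤ 1ℤ
    indicator≤1 true  = ℤₚ.≤-refl
    indicator≤1 false = ℤ.+≤+ ℕ.z≤n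

  codeg : Fin n → ℕ
  codeg u = n ∸ deg G u

  module _ (a b : ℕ) (a≤b : a ≤ b) where

    open Weighted a b a≤b

    -- Vertex `u` pays `b * codeg u` on each of its `n - codeg u` edges, which is the first term of
    -- `gain`. Its excess payments go only to neighbours, and extending them to all vertices can
    -- only increase the sum.
    MoStar≤total : + (a + b) ℤ.* + MoStar G ℤ.≤ total (+ n) (map codeg V)
    MoStar≤total = begin
      + (a + b) ℤ.* + MoStar G
        ≤⟨ MoStar≤∑ (a + b) (λ u v → + h u v) (λ _ _ → ℤ.+≤+ ℕ.z≤n) (λ u v → ℤ.+≤+ (cost≤h u v)) ⟩
      ∑ V (λ u → ∑ V (λ v → if adj G u v then + h u v else 0ℤ))
        ≤⟨ ∑-mono-≤ (All.universal (λ u → row u) V) ⟩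
      ∑ V (gain (+ n) (map codeg V) ∘ codeg)
        ≡⟨ ∑-map codeg _ V ⟨
      total (+ n) (map codeg V) ∎
      where
      open ℤₚ.≤-Reasoning
      h : Fin n → Fin n → ℕ
      h u v = b * codeg u + (a * codeg u ∸ b * codeg v)

      cost≤h : ∀ u v → (a + b) * (n ∸ (deg G u ⊓ deg G v)) ≤ h u v + h v u
      cost≤h u v = subst (λ m → (a + b) * m ≤ h u v + h v u)
        (≡-sym (ℕₚ.∸-distribˡ-⊓-⊔ n (deg G u) (deg G v))) (weighted-⊔-≤ (codeg u) (codeg v))

      entry : ∀ u v → (if adj G u v then + h u v else 0ℤ) ℤ.≤
        b′ ℤ.* + codeg u ℤ.* + (if adj G u v then 1 else 0) ℤ.+ excess (codeg u) (codeg v)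
      entry u v with adj G u v
      ... | true  = ℤₚ.≤-reflexive (trans (ℤₚ.pos-+ (b * codeg u) _)
        (cong (ℤ._+ excess (codeg u) (codeg v)) (trans (ℤₚ.pos-* b _) (≡-sym (ℤₚ.*-identityʳ _)))))
      ... | false = subst (0ℤ ℤ.≤_) (cong (ℤ._+ excess (codeg u) (codeg v)) (≡-sym (ℤₚ.*-zeroʳ (b′ ℤ.* + codeg u))))
        (ℤ.+≤+ ℕ.z≤n)

      deg≡ : ∀ u → + deg G u ≡ + n ℤ.- + codeg u
      deg≡ u = trans (cong +_ (≡-sym (ℕₚ.m∸[m∸n]≡n (deg≤n u)))) (pos-∸ (ℕₚ.m∸n≤m n (deg G u)))

      row : ∀ u → ∑ V (λ v → if adj G u v then + h u v else 0ℤ) ℤ.≤ gain (+ n) (map codeg V) (codeg u)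
      row u = begin
        ∑ V (λ v → if adj G u v then + h u v else 0ℤ)
          ≤⟨ ∑-mono-≤ (All.universal (entry u) V) ⟩
        ∑ V (λ v → b′ ℤ.* + codeg u ℤ.* + (if adj G u v then 1 else 0) ℤ.+ excess (codeg u) (codeg v))
          ≡⟨ ∑-distrib-+ _ (excess (codeg u) ∘ codeg) V ⟩
        ∑ V (λ v → b′ ℤ.* + codeg u ℤ.* + (if adj G u v then 1 else 0)) ℤ.+ ∑ V (excess (codeg u) ∘ codeg)
          ≡⟨ cong₂ ℤ._+_ (*-distribˡ-∑ (b′ ℤ.* + codeg u) _ V) (∑-map codeg (excess (codeg u)) V) ⟨
        b′ ℤ.* + codeg u ℤ.* ∑ V (λ v → + (if adj G u v then 1 else 0)) ℤ.+ ∑ (map codeg V) (excess (codeg u))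
          ≡⟨ cong (ℤ._+ ∑ (map codeg V) (excess (codeg u)))
               (trans (cong (b′ ℤ.* + codeg u ℤ.*_) (trans (≡-sym (pos-deg u)) (deg≡ u)))
                      (ℤₚ.*-assoc b′ (+ codeg u) _)) ⟩
        gain (+ n) (map codeg V) (codeg u) ∎

    -- The negative term of `Q` is moved to the left, so that the inequality can be stated in the
    -- naturals.
    MoStar-weighted : 3 * b * ((a + b) * MoStar G) + a * b * n ^ 3 ≤ (a * a + b * b) * n ^ 3
    MoStar-weighted = ℤₚ.drop‿+≤+ (begin
      + (3 * b * ((a + b) * MoStar G) + a * b * n ^ 3)
        ≡⟨ ℤₚ.pos-+ (3 * b * ((a + b) * MoStar G)) _ ⟩
      + (3 * b * ((a + b) * MoStar G)) ℤ.+ + (a * b * n ^ 3)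
        ≡⟨ cong₂ ℤ._+_ (trans (ℤₚ.pos-* (3 * b) _) (cong₂ ℤ._*_ (ℤₚ.pos-* 3 b) (ℤₚ.pos-* (a + b) _)))
             (trans (ℤₚ.pos-* (a * b) _) (cong₂ ℤ._*_ (ℤₚ.pos-* a b) cube)) ⟩
      + 3 ℤ.* b′ ℤ.* (+ (a + b) ℤ.* + MoStar G) ℤ.+ a′ ℤ.* b′ ℤ.* N³
        ≤⟨ ℤₚ.+-monoˡ-≤ (a′ ℤ.* b′ ℤ.* N³) (ℤₚ.≤-trans
             (ℤₚ.*-monoˡ-≤-nonNeg (+ 3 ℤ.* b′) {{subst ℤ.NonNegative (ℤₚ.pos-* 3 b) _}} MoStar≤total)
             (subst (λ m → Bounded m (total (+ m) (map codeg V))) size (total-bound (map codeg V)))) ⟩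
      Q ℤ.* N³ ℤ.+ a′ ℤ.* b′ ℤ.* N³
        ≡⟨ lemma a′ b′ N³ ⟩
      (a′ ℤ.* a′ ℤ.+ b′ ℤ.* b′) ℤ.* N³
        ≡⟨ cong₂ ℤ._*_ (trans (ℤₚ.pos-+ (a * a) _) (cong₂ ℤ._+_ (ℤₚ.pos-* a a) (ℤₚ.pos-* b b))) cube ⟨
      + (a * a + b * b) ℤ.* + (n ^ 3)
        ≡⟨ ℤₚ.pos-* (a * a + b * b) _ ⟨
      + ((a * a + b * b) * n ^ 3) ∎)
      where
      open ℤₚ.≤-Reasoning
      N³ : ℤ
      N³ = + n ℤ.* + n ℤ.* + n

      size : length (map codeg V) ≡ n
      size = trans (length-map codeg V) length-V

      cube : + (n ^ 3) ≡ N³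
      cube = trans (cong +_ (flat n)) (trans (ℤₚ.pos-* (n * n) n) (cong (ℤ._* + n) (ℤₚ.pos-* n n)))
        where
        flat : ∀ m → m * (m * (m * 1)) ≡ m * m * m
        flat = ℕ-Solver.solve-∀

      lemma : ∀ a b x → (a ℤ.* a ℤ.- a ℤ.* b ℤ.+ b ℤ.* b) ℤ.* x ℤ.+ a ℤ.* b ℤ.* x
        ≡ (a ℤ.* a ℤ.+ b ℤ.* b) ℤ.* x
      lemma = solve-∀

-- Choice of weights and the numerical constant

-- The weights a = b = 1 give 6 M ≤ X, which makes the optimal weights 3 M + X and 2 X admissible.
weighted⇒quadratic : ∀ M X →
  (∀ a b → a ≤ b → 3 * b * ((a + b) * M) + a * b * X ≤ (a * a + b * b) * X) →
  3 * (M + X) ^ 2 ≤ 4 * X ^ 2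
weighted⇒quadratic M X bound = from X refl
  where
  6M≤X : 6 * M ≤ X
  6M≤X = ℕₚ.+-cancelʳ-≤ X _ _ (subst₂ _≤_ (e₁ M X) (e₂ X) (bound 1 1 ℕₚ.≤-refl))
    where
    e₁ : ∀ M X → 3 * 1 * ((1 + 1) * M) + 1 * 1 * X ≡ 6 * M + X
    e₁ = ℕ-Solver.solve-∀
    e₂ : ∀ X → (1 * 1 + 1 * 1) * X ≡ X + X
    e₂ = ℕ-Solver.solve-∀

  -- With `r = a / b` the hypothesis reads `X r² - (3M + X) r + (X - 3M) ≥ 0`. For `X > 0` the left
  -- side is least at `r = (3M + X) / (2X)`, where it becomes the discriminant condition.
  3M+X≤2X : 3 * M + X ≤ 2 * X
  3M+X≤2X = begin
    3 * M + X   ≤⟨ ℕₚ.+-monoˡ-≤ X (ℕₚ.≤-trans (ℕₚ.*-monoˡ-≤ M (ℕₚ.m≤m+n 3 3)) 6M≤X) ⟩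
    X + X       ≡⟨ cong (λ s → X + s) (ℕₚ.+-identityʳ X) ⟨
    2 * X       ∎
    where open ℕₚ.≤-Reasoning

  -- The part shared by both sides once the factor `X` is cancelled and `9 * (X * X)` is added;
  -- removing it leaves three times the claim.
  Z : ℕ
  Z = 9 * (M * M) + 6 * (M * X) + 2 * (X * X)

  e₃ : ∀ M X → 3 * (2 * X) * ((3 * M + X + 2 * X) * M) + (3 * M + X) * (2 * X) * X
    ≡ X * (18 * (M * M) + 24 * (M * X) + 2 * (X * X))
  e₃ = ℕ-Solver.solve-∀

  e₄ : ∀ M X → ((3 * M + X) * (3 * M + X) + 2 * X * (2 * X)) * X
    ≡ X * (9 * (M * M) + 6 * (M * X) + 5 * (X * X))
  e₄ = ℕ-Solver.solve-∀

  e₅ : ∀ M X → 18 * (M * M) + 24 * (M * X) + 2 * (X * X) + 9 * (X * X)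
    ≡ 9 * (M * M) + 6 * (M * X) + 2 * (X * X) + 3 * (3 * ((M + X) * ((M + X) * 1)))
  e₅ = ℕ-Solver.solve-∀

  e₆ : ∀ M X → 9 * (M * M) + 6 * (M * X) + 5 * (X * X) + 9 * (X * X)
    ≡ 9 * (M * M) + 6 * (M * X) + 2 * (X * X) + 3 * (4 * (X * (X * 1)))
  e₆ = ℕ-Solver.solve-∀

  from : ∀ Y → Y ≡ X → 3 * (M + X) ^ 2 ≤ 4 * X ^ 2
  -- For `X = 0` the factor `X` cannot be cancelled, but `6 * M ≤ X` forces `M = 0`.
  from zero    refl = subst (λ m → 3 * (m + 0) ^ 2 ≤ 0)
    (≡-sym (ℕₚ.n≤0⇒n≡0 (ℕₚ.≤-trans (ℕₚ.m≤m+n M _) 6M≤X))) ℕ.z≤n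
  from (suc _) refl = ℕₚ.*-cancelˡ-≤ 3 (ℕₚ.+-cancelˡ-≤ Z _ _
    (subst₂ _≤_ (e₅ M X) (e₆ M X) (ℕₚ.+-monoˡ-≤ (9 * (X * X))
      (ℕₚ.*-cancelˡ-≤ X (subst₂ _≤_ (e₃ M X) (e₄ M X) (bound (3 * M + X) (2 * X) 3M+X≤2X))))))

-- The hypotheses say `x ≤ √(q/p) y` and `r √(q/p) ≤ s`. Comparing squares avoids the root:
-- `s * y < r * x` would contradict their product.
ratio-≤ : ∀ p q r s x y .{{_ : ℕ.NonZero p}} →
  p * (x * x) ≤ q * (y * y) → q * (r * r) ≤ p * (s * s) → r * x ≤ s * y
ratio-≤ p q r s x y px²≤qy² qr²≤ps² with r * x ℕ.≤? s * y
... | yes rx≤sy = rx≤sy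
... | no  rx≰sy = contradiction (begin
    p * (r * x * (r * x))    ≡⟨ square-* p r x ⟩
    r * r * (p * (x * x))    ≤⟨ ℕₚ.*-monoʳ-≤ (r * r) px²≤qy² ⟩
    r * r * (q * (y * y))    ≡⟨ regroup q r y ⟩
    q * (r * r) * (y * y)    ≤⟨ ℕₚ.*-monoˡ-≤ (y * y) qr²≤ps² ⟩
    p * (s * s) * (y * y)    ≡⟨ square-*′ p s y ⟩
    p * (s * y * (s * y))    ∎)
  (ℕₚ.<⇒≱ (ℕₚ.*-monoʳ-< p (ℕₚ.*-mono-< (ℕₚ.≰⇒> rx≰sy) (ℕₚ.≰⇒> rx≰sy))))
  where
  open ℕₚ.≤-Reasoning
  square-* : ∀ p r x → p * (r * x * (r * x)) ≡ r * r * (p * (x * x))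
  square-* = ℕ-Solver.solve-∀
  regroup : ∀ q r y → r * r * (q * (y * y)) ≡ q * (r * r) * (y * y)
  regroup = ℕ-Solver.solve-∀
  square-*′ : ∀ p s y → p * (s * s) * (y * y) ≡ p * (s * y * (s * y))
  square-*′ = ℕ-Solver.solve-∀

-- The first component is `MoStar G + n³ ≤ (2/√3) n³` with both nonnegative sides squared and
-- denominators cleared.
theorem1 : (n : ℕ) (G : SimpleGraph n) →
    (3 * (MoStar G + n ^ 3) ^ 2 ≤ 4 * n ^ 6) × (10000 * MoStar G ≤ 1548 * n ^ 3)
theorem1 n G = subst (λ m → 3 * (M + X) ^ 2 ≤ 4 * m) (ℕₚ.^-*-assoc n 3 2) quadratic , linear
  where
  open ℕₚ.≤-Reasoning
  M X : ℕ
  M = MoStar G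
  X = n ^ 3

  quadratic : 3 * (M + X) ^ 2 ≤ 4 * X ^ 2
  quadratic = weighted⇒quadratic M X (MoStar-weighted G)

  square : ∀ m → m ^ 2 ≡ m * m
  square m = cong (m *_) (ℕₚ.*-identityʳ m)

  -- `1.1548` is a decimal upper bound for `2/√3`, checked as `4 * 10000² ≤ 3 * 11548²`.
  10000[M+X]≤11548X : 10000 * (M + X) ≤ 11548 * X
  10000[M+X]≤11548X = ratio-≤ 3 4 10000 11548 (M + X) X
    (subst₂ (λ i j → 3 * i ≤ 4 * j) (square (M + X)) (square X) quadratic)
    (ℕₚ.≤ᵇ⇒≤ (4 * (10000 * 10000)) (3 * (11548 * 11548)) _)

  linear : 10000 * M ≤ 1548 * X
  linear = ℕₚ.+-cancelʳ-≤ (10000 * X) _ _ (begin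
    10000 * M + 10000 * X   ≡⟨ ℕₚ.*-distribˡ-+ 10000 M X ⟨
    10000 * (M + X)         ≤⟨ 10000[M+X]≤11548X ⟩
    11548 * X               ≡⟨ ℕₚ.*-distribʳ-+ X 1548 10000 ⟩
    1548 * X + 10000 * X    ∎)
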